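{- Let $n\ge 1$ and let $\lambda=(\lambda_1,\dots,\lambda_l)$ be a partition of $n$, identified with its Young diagram. For each standard Young tableau $P$ of shape $\lambda$ let $$\mathfrak{h}_P(\mathbf{x})=\sum_{Q\in\mathfrak{st}_\lambda}\ \prod_{\alpha\in\lambda}x_{q_{P,Q}(\alpha)},$$ where $\mathfrak{st}_\lambda$ is the set of standard Young tableaux of shape $\lambda$, $q_{P,Q}$ is the $P$-pedestal of $Q$, and $\mathbf{x}=(x_0,x_1,x_2,\dots)$ are commuting variables. Then $\mathfrak{h}_P(\mathbf{x})$ does not depend on $P$: for all $P,P'\in\mathfrak{st}_\lambda$ one has $\mathfrak{h}_P(\mathbf{x})=\mathfrak{h}_{P'}(\mathbf{x})$.
   Context: A partition $\lambda=(\lambda_1\ge\dots\ge\lambda_l>0)$ of $n$ is identified with the set of nodes $(i,j)$ with $1\le i\le l$, $1\le j\le\lambda_i$. A standard Young tableau of shape $\lambda$ is a bijection $Q\colon\lambda\to\{1,\dots,n\}$ such that $Q(i,j)$ increases in $i$ and in $j$; the set of these is $\mathfrak{st}_\lambda$. For $Q\in\mathfrak{st}_\lambda$, the linear order $\preccurlyeq_Q$ on the nodes is given by $\alpha\prec_Q\beta$ iff $Q(\alpha)<Q(\beta)$. Given $P,Q\in\mathfrak{st}_\lambda$, let $\alpha_1\prec_Q\alpha_2\prec_Q\dots\prec_Q\alpha_n$ be the list of all nodes of $\lambda$ enumerated according to $\preccurlyeq_Q$. A node $\alpha_k$ (with $1\le k<n$) is called a $(P,Q)$-disagreement node if $\alpha_{k+1}\prec_P\alpha_k$.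 The $P$-pedestal of $Q$ is the function $q_{P,Q}\colon\lambda\to\mathbb{Z}_{\ge 0}$ defined by $$q_{P,Q}(\alpha_k)=\#\{\,l : l<k,\ \alpha_l\text{ is a }(P,Q)\text{ -disagreement node}\,\}.$$ -}

module Defs where

open import Algebra.Bundles using (CommutativeRing)
open import Algebra.Structures using (IsCommutativeRing)
open import Data.Fin.Base as Fin using (Fin; zero; suc; toℕ)
import Data.Fin.Properties as Fin
open import Data.List.Base as List
  using (List; []; _∷_; [_]; length; lookup; map; foldr; filter; mapMaybe; allFin; concatMap; cartesianProductWith)
import Data.List.Membership.Propositional.Properties as ∈
import Data.List.Membership.Setoid as Membership
import Data.List.Membership.Setoid.Properties as Membershipₚ
import Data.List.Relation.Unary.All as All
open import Data.List.Relation.Unary.All using (All)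
import Data.List.Relation.Unary.AllPairs as AllPairs
import Data.List.Relation.Unary.Any as Any
open import Data.List.Relation.Unary.Any using (here; there)
open import Data.List.Relation.Unary.Enumerates.Setoid using (IsEnumeration)
open import Data.List.Relation.Unary.Linked using (Linked)
open import Data.List.Relation.Unary.Unique.Setoid using (Unique)
import Data.List.Relation.Unary.Unique.Propositional.Properties as UniqueP
import Data.List.Relation.Unary.Unique.Setoid.Properties as UniqueS
open import Data.Maybe.Base as Maybe using (Maybe; just; nothing)
open import Data.Nat.Base using (ℕ; zero; suc; _<_; _≥_)
import Data.Nat.ListAction as ℕ
import Data.Nat.Properties as ℕ
open import Data.Product.Base using (Σ; ∃; ∃-syntax; _×_; _,_; proj₁; proj₂; uncurry; curry)
import Data.Product.Properties as Product
open import Function.Base using (_∘_; _on_)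
open import Function.Definitions using (Bijective)
open import Level using (Level; 0ℓ)
open import Relation.Binary.Bundles using (Setoid)
open import Relation.Binary.PropositionalEquality
  using (_≡_; _≗_; refl; sym; trans; subst₂; setoid)
open import Relation.Nullary.Decidable using (Dec; yes; no; map′; _×-dec_; _→-dec_)
open import Relation.Nullary.Negation using (contradiction)
open import Relation.Unary using (Pred; Decidable)

private
  variable
    a ℓ p : Level
    n : ℕ

record Partition (n : ℕ) : Set where
  field
    parts      : List ℕ
    decreasing : Linked _≥_ parts
    positive   : All (0 <_) parts
    sum≡       : ℕ.sum parts ≡ n

open Partition public

-- The pair (i , j) stands for the node (i + 1 , j + 1).
Node : Partition n → Set
Node μ = Σ (Fin (length (parts μ))) λ i → Fin (lookup (parts μ) i)

row column : ∀ {l} {r : Fin l → ℕ} → Σ (Fin l) (λ i → Fin (r i)) → ℕ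
row    (i , _) = toℕ i
column (_ , j) = toℕ j

nodes : (μ : Partition n) → List (Node μ)
nodes μ = concatMap (λ i → map (i ,_) (allFin _)) (allFin _)

module _ (μ : Partition n) where

  _≟ᴺ_ : (α β : Node μ) → Dec (α ≡ β)
  _≟ᴺ_ = Product.≡-dec Fin._≟_ Fin._≟_

  all?ᴺ : {P : Pred (Node μ) p} → Decidable P → Dec (∀ α → P α)
  all?ᴺ P? = map′ uncurry curry (Fin.all? λ i → Fin.all? λ j → P? (i , j))

  any?ᴺ : {P : Pred (Node μ) p} → Decidable P → Dec (∃ P)
  any?ᴺ P? = map′ (λ (i , j , Pij) → (i , j) , Pij) (λ ((i , j) , Pij) → i , j , Pij)
                  (Fin.any? λ i → Fin.any? λ j → P? (i , j))

-- The value k : Fin n stands for the entry k + 1.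
Filling : Partition n → Set
Filling {n} μ = Node μ → Fin n

record IsStandard (μ : Partition n) (Q : Filling μ) : Set where
  field
    bijective        : Bijective _≡_ _≡_ Q
    increasing-in-i  : ∀ α β → column α ≡ column β → row α < row β → Q α Fin.< Q β
    increasing-in-j  : ∀ α β → row α ≡ row β → column α < column β → Q α Fin.< Q β

record StandardTableau (μ : Partition n) : Set where
  constructor tableau
  field
    entry      : Filling μ
    isStandard : IsStandard μ entry

open StandardTableau public

isStandard? : (μ : Partition n) → Decidable (IsStandard μ)
isStandard? μ Q =
  map′ (λ ((inj , surj) , inc-i , inc-j) → record
         { bijective       = (λ {α} {β} → inj α β) , λ k → proj₁ (surj k) , λ where refl → proj₂ (surj k)
         ; increasing-in-i = inc-i
         ; increasing-in-j = inc-j })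
       (λ std → let open IsStandard std in
         ((λ α β → proj₁ bijective) , (λ k → let α , eq = proj₂ bijective k in α , eq refl))
         , increasing-in-i , increasing-in-j)
       (((all?ᴺ μ λ α → all?ᴺ μ λ β → (Q α Fin.≟ Q β) →-dec (_≟ᴺ_ μ α β))
         ×-dec (Fin.all? λ k → any?ᴺ μ λ α → Q α Fin.≟ k))
        ×-dec (all?ᴺ μ λ α → all?ᴺ μ λ β →
                 (column α ℕ.≟ column β) →-dec (row α ℕ.<? row β) →-dec (Q α Fin.<? Q β))
        ×-dec (all?ᴺ μ λ α → all?ᴺ μ λ β →
                 (row α ℕ.≟ row β) →-dec (column α ℕ.<? column β) →-dec (Q α Fin.<? Q β)))

𝔰𝔱 : Partition n → Setoid 0ℓ 0ℓ
𝔰𝔱 μ = record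
  { Carrier       = StandardTableau μ
  ; _≈_           = _≗_ on entry
  ; isEquivalence = record
    { refl  = λ _ → refl
    ; sym   = λ eq α → sym (eq α)
    ; trans = λ eq₁ eq₂ α → trans (eq₁ α) (eq₂ α) }
  }

choices : ∀ {m} {A : Fin m → Set a} → (∀ i → List (A i)) → List (∀ i → A i)
choices {m = zero}  xs = [ (λ ()) ]
choices {m = suc _} xs =
  cartesianProductWith Fin.∀-cons (xs zero) (choices (xs ∘ suc))

fillings : (μ : Partition n) → List (Filling μ)
fillings μ = map uncurry (choices λ i → choices λ j → allFin _)

toTableau : (μ : Partition n) → Filling μ → Maybe (StandardTableau μ)
toTableau μ Q with isStandard? μ Q
... | yes std = just (tableau Q std)
... | no  _   = nothing

standardTableaux : (μ : Partition n) → List (StandardTableau μ)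
standardTableaux μ = mapMaybe (toTableau μ) (fillings μ)

Πₛ : ∀ {m} → (Fin m → Setoid a ℓ) → Setoid a ℓ
Πₛ S = record
  { Carrier       = ∀ i → Setoid.Carrier (S i)
  ; _≈_           = λ f g → ∀ i → Setoid._≈_ (S i) (f i) (g i)
  ; isEquivalence = record
    { refl  = λ i → Setoid.refl (S i)
    ; sym   = λ eq i → Setoid.sym (S i) (eq i)
    ; trans = λ eq₁ eq₂ i → Setoid.trans (S i) (eq₁ i) (eq₂ i) }
  }

choices-complete : ∀ {m} (S : Fin m → Setoid a ℓ) {xs : ∀ i → List (Setoid.Carrier (S i))} →
                   (∀ i → IsEnumeration (S i) (xs i)) → IsEnumeration (Πₛ S) (choices xs)
choices-complete {m = zero}  S enum f = here λ ()
choices-complete {m = suc _} S enum f = Any.map (λ eq → λ where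
    zero    → eq zero
    (suc i) → eq (suc i))
  (Membershipₚ.∈-cartesianProductWith⁺ (S zero) (Πₛ (S ∘ suc)) (Πₛ S)
    (λ where eq₀ eqₛ zero    → eq₀
             eq₀ eqₛ (suc i) → eqₛ i)
    (enum zero (f zero)) (choices-complete (S ∘ suc) (enum ∘ suc) (f ∘ suc)))

choices-unique : ∀ {m} (S : Fin m → Setoid a ℓ) {xs : ∀ i → List (Setoid.Carrier (S i))} →
                 (∀ i → Unique (S i) (xs i)) → Unique (Πₛ S) (choices xs)
choices-unique {m = zero}  S uniq = All.[] AllPairs.∷ AllPairs.[]
choices-unique {m = suc _} S uniq =
  UniqueS.cartesianProductWith⁺ (S zero) (Πₛ (S ∘ suc)) (Πₛ S) _
    (λ eq → eq zero , eq ∘ suc)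
    (uniq zero) (choices-unique (S ∘ suc) (uniq ∘ suc))

IsStandard-resp-≗ : (μ : Partition n) {Q R : Filling μ} → Q ≗ R → IsStandard μ Q → IsStandard μ R
IsStandard-resp-≗ μ {Q} {R} eq std = record
  { bijective       = (λ {α} {β} e → proj₁ bijective (trans (eq α) (trans e (sym (eq β)))))
                    , λ k → let α , f = proj₂ bijective k in
                            α , λ where refl → trans (sym (eq α)) (f refl)
  ; increasing-in-i = λ α β c r → subst₂ Fin._<_ (eq α) (eq β) (increasing-in-i α β c r)
  ; increasing-in-j = λ α β r c → subst₂ Fin._<_ (eq α) (eq β) (increasing-in-j α β r c)
  }
  where open IsStandard std

private
  rowChoice : (μ : Partition n) → Fin (length (parts μ)) → Setoid 0ℓ 0ℓ
  rowChoice {n} μ i = Πₛ {m = lookup (parts μ) i} λ _ → setoid (Fin n)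

  curriedFilling : Partition n → Setoid 0ℓ 0ℓ
  curriedFilling μ = Πₛ (rowChoice μ)

-- standardTableaux-complete and standardTableaux-unique: a sum over the list
-- is a sum over 𝔰𝔱, each tableau occurring once up to equality of entries.
standardTableaux-complete : (μ : Partition n) → IsEnumeration (𝔰𝔱 μ) (standardTableaux μ)
standardTableaux-complete {n} μ Q = go _
  (choices-complete (rowChoice μ)
    (λ i → choices-complete (λ _ → setoid (Fin n)) λ j → ∈.∈-allFin) (curry (entry Q)))
  where
  open Membership (𝔰𝔱 μ) using (_∈_)

  go : ∀ fs → Any.Any (Setoid._≈_ (curriedFilling μ) (curry (entry Q))) fs →
       Q ∈ mapMaybe (toTableau μ) (map uncurry fs)
  go (f ∷ fs) f∈ with isStandard? μ (uncurry f) | f∈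
  ... | yes std | here eq  = here λ (i , j) → eq i j
  ... | yes std | there q  = there (go fs q)
  ... | no ¬std | here eq  =
    contradiction (IsStandard-resp-≗ μ (λ (i , j) → eq i j) (isStandard Q)) ¬std
  ... | no ¬std | there q  = go fs q

standardTableaux-unique : (μ : Partition n) → Unique (𝔰𝔱 μ) (standardTableaux μ)
standardTableaux-unique {n} μ = go _
  (choices-unique (rowChoice μ) λ i → choices-unique (λ _ → setoid (Fin n)) λ j → UniqueP.allFin⁺ n)
  where
  new : ∀ f fs (std : IsStandard μ (uncurry f)) →
        All (λ g → Setoid._≉_ (curriedFilling μ) f g) fs →
        All (Setoid._≉_ (𝔰𝔱 μ) (tableau (uncurry f) std)) (mapMaybe (toTableau μ) (map uncurry fs))
  new f []       std All.[]          = All.[]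
  new f (g ∷ fs) std (f≉g All.∷ f≉) with isStandard? μ (uncurry g)
  ... | yes _ = (λ eq → f≉g λ i j → eq (i , j)) All.∷ new f fs std f≉
  ... | no  _ = new f fs std f≉

  go : ∀ fs → Unique (curriedFilling μ) fs → Unique (𝔰𝔱 μ) (mapMaybe (toTableau μ) (map uncurry fs))
  go []       AllPairs.[]            = AllPairs.[]
  go (f ∷ fs) (f≉ AllPairs.∷ uniq) with isStandard? μ (uncurry f)
  ... | yes std = new f fs std f≉ AllPairs.∷ go fs uniq
  ... | no  _   = go fs uniq

module _ {μ : Partition n} where

  _≺[_]_ : Node μ → StandardTableau μ → Node μ → Set
  α ≺[ Q ] β = entry Q α Fin.< entry Q β

  -- If α is the k-th node in the order of Q, then β is the (k+1)-st.
  NextNode : StandardTableau μ → Node μ → Node μ → Set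
  NextNode Q α β = toℕ (entry Q β) ≡ suc (toℕ (entry Q α))

  Disagreement : (P Q : StandardTableau μ) → Node μ → Set
  Disagreement P Q α = ∃[ β ] NextNode Q α β × β ≺[ P ] α

  disagreement? : ∀ P Q → Decidable (Disagreement P Q)
  disagreement? P Q α = any?ᴺ μ λ β →
    (toℕ (entry Q β) ℕ.≟ suc (toℕ (entry Q α))) ×-dec (entry P β Fin.<? entry P α)

  -- With α = αₖ, the nodes β = αₗ counted here are those with l < k.
  pedestal : (P Q : StandardTableau μ) → Node μ → ℕ
  pedestal P Q α =
    length (filter (λ β → (entry Q β Fin.<? entry Q α) ×-dec disagreement? P Q β) (nodes μ))

-- The polynomial ring ℤ[x₀, x₁, x₂, …], as the free commutative ring on
-- the variables: ring expressions modulo the congruence generated by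
-- the commutative ring axioms.

module Polynomials where

  infix  8 -_
  infixl 7 _*_
  infixl 6 _+_
  infix  4 _≈_

  data Polynomial : Set where
    x       : ℕ → Polynomial
    0# 1#   : Polynomial
    _+_ _*_ : Polynomial → Polynomial → Polynomial
    -_      : Polynomial → Polynomial

  data _≈_ : Polynomial → Polynomial → Set where
    ≈-refl      : ∀ {f} → f ≈ f
    ≈-sym       : ∀ {f g} → f ≈ g → g ≈ f
    ≈-trans     : ∀ {f g h} → f ≈ g → g ≈ h → f ≈ h
    +-cong      : ∀ {f f′ g g′} → f ≈ f′ → g ≈ g′ → f + g ≈ f′ + g′
    *-cong      : ∀ {f f′ g g′} → f ≈ f′ → g ≈ g′ → f * g ≈ f′ * g′
    -‿cong      : ∀ {f f′} → f ≈ f′ → - f ≈ - f′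
    +-assoc     : ∀ f g h → (f + g) + h ≈ f + (g + h)
    +-comm      : ∀ f g → f + g ≈ g + f
    +-identityˡ : ∀ f → 0# + f ≈ f
    -‿inverseˡ  : ∀ f → - f + f ≈ 0#
    *-assoc     : ∀ f g h → (f * g) * h ≈ f * (g * h)
    *-comm      : ∀ f g → f * g ≈ g * f
    *-identityˡ : ∀ f → 1# * f ≈ f
    distribˡ    : ∀ f g h → f * (g + h) ≈ f * g + f * h

  isCommutativeRing : IsCommutativeRing _≈_ _+_ _*_ -_ 0# 1#
  isCommutativeRing = record
    { isRing = record
      { +-isAbelianGroup = record
        { isGroup = record
          { isMonoid = record
            { isSemigroup = record
              { isMagma = record
                { isEquivalence = record { refl = ≈-refl ; sym = ≈-sym ; trans = ≈-trans }
                ; ∙-cong        = +-cong }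
              ; assoc = +-assoc }
            ; identity = +-identityˡ , λ f → ≈-trans (+-comm f 0#) (+-identityˡ f) }
          ; inverse = -‿inverseˡ , λ f → ≈-trans (+-comm f (- f)) (-‿inverseˡ f)
          ; ⁻¹-cong = -‿cong }
        ; comm = +-comm }
      ; *-cong     = *-cong
      ; *-assoc    = *-assoc
      ; *-identity = *-identityˡ , λ f → ≈-trans (*-comm f 1#) (*-identityˡ f)
      ; distrib    = distribˡ , λ f g h →
          ≈-trans (*-comm (g + h) f)
            (≈-trans (distribˡ f g h) (+-cong (*-comm f g) (*-comm f h)))
      }
    ; *-comm = *-comm
    }

open Polynomials public using (Polynomial; x)

ℤ[x] : CommutativeRing 0ℓ 0ℓ
ℤ[x] = record { isCommutativeRing = Polynomials.isCommutativeRing }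

-- Substitution respects ≈, so an identity of ℤ[x] holds in every
-- commutative ring; in particular ≈ identifies no distinct polynomials.
module _ {c ℓ} (R : CommutativeRing c ℓ) where
  open CommutativeRing R
  private module F = Polynomials

  evaluate : (ℕ → Carrier) → Polynomial → Carrier
  evaluate ρ (x i)     = ρ i
  evaluate ρ F.0#      = 0#
  evaluate ρ F.1#      = 1#
  evaluate ρ (f F.+ g) = evaluate ρ f + evaluate ρ g
  evaluate ρ (f F.* g) = evaluate ρ f * evaluate ρ g
  evaluate ρ (F.- f)   = - evaluate ρ f

  evaluate-cong : ∀ ρ {f g} → f F.≈ g → evaluate ρ f ≈ evaluate ρ g
  evaluate-cong ρ F.≈-refl            = CommutativeRing.refl R
  evaluate-cong ρ (F.≈-sym e)         = CommutativeRing.sym R (evaluate-cong ρ e)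
  evaluate-cong ρ (F.≈-trans e e′)    = CommutativeRing.trans R (evaluate-cong ρ e) (evaluate-cong ρ e′)
  evaluate-cong ρ (F.+-cong e e′)     = +-cong (evaluate-cong ρ e) (evaluate-cong ρ e′)
  evaluate-cong ρ (F.*-cong e e′)     = *-cong (evaluate-cong ρ e) (evaluate-cong ρ e′)
  evaluate-cong ρ (F.-‿cong e)        = -‿cong (evaluate-cong ρ e)
  evaluate-cong ρ (F.+-assoc f g h)   = +-assoc _ _ _
  evaluate-cong ρ (F.+-comm f g)      = +-comm _ _
  evaluate-cong ρ (F.+-identityˡ f)   = +-identityˡ _
  evaluate-cong ρ (F.-‿inverseˡ f)    = -‿inverseˡ _
  evaluate-cong ρ (F.*-assoc f g h)   = *-assoc _ _ _
  evaluate-cong ρ (F.*-comm f g)      = *-comm _ _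
  evaluate-cong ρ (F.*-identityˡ f)   = *-identityˡ _
  evaluate-cong ρ (F.distribˡ f g h)  = distribˡ _ _ _

module _ where
  open CommutativeRing ℤ[x] using (_+_; _*_; 0#; 1#)

  ∑ ∏ : List Polynomial → Polynomial
  ∑ = foldr _+_ 0#
  ∏ = foldr _*_ 1#

𝔥 : {μ : Partition n} → StandardTableau μ → Polynomial
𝔥 {μ = μ} P =
  ∑ (map (λ Q → ∏ (map (λ α → x (pedestal P Q α)) (nodes μ))) (standardTableaux μ))

{-# OPTIONS --safe #-}
module Submission where

-- Let α, β be consecutive in P but in the opposite order in P′; then they are
-- incomparable in μ, and exchanging them in P gives a standard tableau Pσ,
-- where σ = (α β).  Let Q ↦ Q̃ exchange α and β in Q if they are consecutive
-- in Q, and fix Q otherwise.  This is an involution of 𝔰𝔱 that carries the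
-- P-pedestal of Q to the Pσ-pedestal of Q̃ up to σ: in the first case both
-- tableaux are relabelled by σ, and in the second case no pair of consecutive
-- nodes of Q is compared differently by P and Pσ.  Hence 𝔥 P = 𝔥 Pσ, and such
-- exchanges sort P into P′.

open import Defs
open import Algebra.Bundles using (CommutativeRing)
open import Data.Fin.Base as Fin using (Fin; toℕ)
import Data.Fin.Properties as Fin
open import Data.List.Base
  using (List; []; _∷_; _++_; length; map; filter; allFin; cartesianProduct)
import Data.List.Membership.Propositional as ∈
import Data.List.Membership.Propositional.Properties as ∈ₚ
import Data.List.Membership.Setoid as Membership
import Data.List.Membership.Setoid.Properties as Membershipₚ
open import Data.List.Properties using (length-map; map-∘; map-cong; filter-≐)
open import Data.List.Relation.Binary.Disjoint.Propositional using (Disjoint)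
import Data.List.Relation.Binary.Permutation.Setoid as Permutation
import Data.List.Relation.Binary.Permutation.Setoid.Properties as Permutationₚ
import Data.List.Relation.Unary.All as All
import Data.List.Relation.Unary.All.Properties as All
import Data.List.Relation.Unary.AllPairs as AllPairs
import Data.List.Relation.Unary.AllPairs.Properties as AllPairs
open import Data.List.Relation.Unary.Any using (here; there)
open import Data.List.Relation.Unary.Enumerates.Setoid using (IsEnumeration)
open import Data.List.Relation.Unary.Unique.Setoid using (Unique)
import Data.List.Relation.Unary.Unique.Propositional.Properties as UniqueP
import Data.List.Relation.Unary.Unique.Setoid.Properties as UniqueS
open import Data.Nat.Base using (ℕ; zero; suc; _≤_; _<_; s≤s)
open import Data.Nat.Induction using (<-wellFounded)
import Data.Nat.Properties as ℕ
open import Data.Product.Base using (_×_; _,_; proj₁; proj₂; ∃-syntax; map₂)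
open import Data.Sum.Base as Sum using (_⊎_; inj₁; inj₂)
open import Function.Base using (_∘_; id)
open import Function.Definitions using (Injective)
open import Induction.WellFounded using (Acc; acc)
open import Level using (Level)
open import Relation.Binary.Bundles using (Setoid)
open import Relation.Binary.Definitions using (DecidableEquality)
open import Relation.Binary.PropositionalEquality
  using (_≡_; _≢_; _≗_; refl; sym; trans; cong; subst; subst₂; setoid)
open import Relation.Nullary.Decidable using (Dec; yes; no; _⊎-dec_; _×-dec_)
open import Relation.Nullary.Negation using (¬_; contradiction)
open import Relation.Unary using (Pred; Decidable; _⊆_; _≐_)
open CommutativeRing ℤ[x] using (_≈_; +-cong; +-isCommutativeMonoid; *-isCommutativeMonoid)
  renaming (setoid to ℤ[x]-setoid; refl to ≈-refl; sym to ≈-sym; trans to ≈-trans; reflexive to ≈-reflexive)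

private
  variable
    a ℓ p q : Level
    n : ℕ

-- Duplicate-free enumerations and permutations, up to a setoid equality

module _ (S : Setoid a ℓ) where
  open Setoid S using () renaming (Carrier to A; _≈_ to _∼_)
  open Membership S using (_∈_)
  open Permutation S using (_↭_; ↭-refl; ↭-sym; ↭-trans; ↭-prep; ↭-reflexive-≋)
  open Permutationₚ S using (∈-resp-↭; Unique-resp-↭; shift)

  -- Induction on `ys`: the head occurs in `zs` and is moved to the front there; as neither list
  -- repeats it, the tails again have the same members. A general setoid is used because tableaux
  -- are compared by their entries only.
  unique∧set⇒↭ : ∀ {ys zs} → Unique S ys → Unique S zs →
                 (∀ {w} → w ∈ ys → w ∈ zs) → (∀ {w} → w ∈ zs → w ∈ ys) → ys ↭ zs
  unique∧set⇒↭ {[]}     {[]}    _ _ _ _ = ↭-refl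
  unique∧set⇒↭ {[]}     {_ ∷ _} _ _ _ zs⊆ys with () ← zs⊆ys (here (Setoid.refl S))
  unique∧set⇒↭ {y ∷ ys} {zs} (y∉ys AllPairs.∷ ys!) zs! ys⊆zs zs⊆ys
    with us , vs , _ , y∼z , zs≋ ← Membershipₚ.∈-∃++ S (ys⊆zs (here (Setoid.refl S)))
    = ↭-trans (↭-prep y ys↭us++vs) (↭-sym zs↭y∷us++vs)
    where
    zs↭y∷us++vs : zs ↭ y ∷ us ++ vs
    zs↭y∷us++vs = ↭-trans (↭-reflexive-≋ zs≋) (shift (Setoid.sym S y∼z) us vs)

    ys↭us++vs : ys ↭ us ++ vs
    ys↭us++vs with Unique-resp-↭ zs↭y∷us++vs zs!
    ... | y∉us++vs AllPairs.∷ us++vs! = unique∧set⇒↭ ys! us++vs! to from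
      where
      to : ∀ {w} → w ∈ ys → w ∈ us ++ vs
      to w∈ with ∈-resp-↭ zs↭y∷us++vs (ys⊆zs (there w∈))
      ... | here w∼y = contradiction (Membershipₚ.∈-resp-≈ S w∼y w∈) (All.All¬⇒¬Any y∉ys)
      ... | there w∈us++vs = w∈us++vs

      from : ∀ {w} → w ∈ us ++ vs → w ∈ ys
      from w∈ with zs⊆ys (∈-resp-↭ (↭-sym zs↭y∷us++vs) (there w∈))
      ... | here w∼y = contradiction (Membershipₚ.∈-resp-≈ S w∼y w∈) (All.All¬⇒¬Any y∉us++vs)
      ... | there w∈ys = w∈ys

  -- An involution is injective, so `map φ ys` has no repetitions, and every `z` is hit as the image
  -- of `φ z`. This reindexes both the product over nodes and the sum over tableaux.
  involution-↭ : ∀ {ys} → IsEnumeration S ys → Unique S ys →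
                 (φ : A → A) → (∀ {y z} → y ∼ z → φ y ∼ φ z) → (∀ y → φ (φ y) ∼ y) →
                 map φ ys ↭ ys
  involution-↭ enum ys! φ φ-cong φφ = unique∧set⇒↭
    (UniqueS.map⁺ S S (λ {y} {z} e → Setoid.trans S (Setoid.sym S (φφ y))
                                       (Setoid.trans S (φ-cong e) (φφ z))) ys!)
    ys!
    (λ _ → enum _)
    (λ {z} _ → Membershipₚ.∈-resp-≈ S (φφ z) (Membershipₚ.∈-map⁺ S S φ-cong (enum (φ z))))

-- Counting by filters

module _ {A : Set a} {P : Pred A p} (P? : Decidable P) where

  filter-map : {B : Set ℓ} (f : B → A) (ys : List B) →
               filter P? (map f ys) ≡ map f (filter (P? ∘ f) ys)
  filter-map f []       = refl
  filter-map f (y ∷ ys) with P? (f y)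
  ... | yes _ = cong (f y ∷_) (filter-map f ys)
  ... | no  _ = filter-map f ys

  module _ {Q : Pred A q} (Q? : Decidable Q) (P⊆Q : P ⊆ Q) where

    length-filter-⊆ : ∀ ys → length (filter P? ys) ≤ length (filter Q? ys)
    length-filter-⊆ []       = ℕ.≤-refl
    length-filter-⊆ (y ∷ ys) with P? y | Q? y
    ... | yes _  | yes _  = s≤s (length-filter-⊆ ys)
    ... | yes Py | no ¬Qy = contradiction (P⊆Q Py) ¬Qy
    ... | no  _  | yes _  = ℕ.m≤n⇒m≤1+n (length-filter-⊆ ys)
    ... | no  _  | no  _  = length-filter-⊆ ys

    length-filter-⊂ : ∀ {y ys} → y ∈.∈ ys → ¬ P y → Q y →
                      length (filter P? ys) < length (filter Q? ys)
    length-filter-⊂ {ys = y ∷ ys} (here refl) ¬Py Qy with P? y | Q? y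
    ... | yes Py | _      = contradiction Py ¬Py
    ... | no  _  | yes _  = s≤s (length-filter-⊆ ys)
    ... | no  _  | no ¬Qy = contradiction Qy ¬Qy
    length-filter-⊂ {ys = z ∷ ys} (there y∈ys) ¬Py Qy with P? z | Q? z
    ... | yes _  | yes _  = s≤s (length-filter-⊂ y∈ys ¬Py Qy)
    ... | yes Pz | no ¬Qz = contradiction (P⊆Q Pz) ¬Qz
    ... | no  _  | yes _  = ℕ.m<n⇒m<1+n (length-filter-⊂ y∈ys ¬Py Qy)
    ... | no  _  | no  _  = length-filter-⊂ y∈ys ¬Py Qy

-- Reordering sums and products

∑-↭ : {fs gs : List Polynomial} → Permutation._↭_ ℤ[x]-setoid fs gs → ∑ fs ≈ ∑ gs
∑-↭ = Permutationₚ.foldr-commMonoid ℤ[x]-setoid +-isCommutativeMonoid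

∑-cong : {A : Set a} {f g : A → Polynomial} → (∀ y → f y ≈ g y) → ∀ ys → ∑ (map f ys) ≈ ∑ (map g ys)
∑-cong f≈g []       = ≈-refl
∑-cong f≈g (y ∷ ys) = +-cong (f≈g y) (∑-cong f≈g ys)

∏-↭ : {fs gs : List Polynomial} → Permutation._↭_ ℤ[x]-setoid fs gs → ∏ fs ≈ ∏ gs
∏-↭ = Permutationₚ.foldr-commMonoid ℤ[x]-setoid *-isCommutativeMonoid

-- Transpositions and consecutive positions

module _ {A : Set a} (_≟_ : DecidableEquality A) where

  transpose : A → A → A → A
  transpose α β γ with γ ≟ α | γ ≟ β
  ... | yes _ | _     = β
  ... | no  _ | yes _ = α
  ... | no  _ | no  _ = γ

  -- Indexed by the value of the transposition, so that matching on a constructor gives this value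
  -- together with the equations behind it.
  data Transpose (α β γ : A) : A → Set a where
    first  : γ ≡ α → Transpose α β γ β
    second : γ ≡ β → Transpose α β γ α
    other  : γ ≢ α → γ ≢ β → Transpose α β γ γ

  transpose-view : ∀ α β γ → Transpose α β γ (transpose α β γ)
  transpose-view α β γ with γ ≟ α | γ ≟ β
  ... | yes γ≡α | _       = first γ≡α
  ... | no  _   | yes γ≡β = second γ≡β
  ... | no  γ≢α | no  γ≢β = other γ≢α γ≢β

  transpose-first : ∀ α β → transpose α β α ≡ β
  transpose-first α β with transpose α β α | transpose-view α β α
  ... | _ | first _     = refl
  ... | _ | second refl = refl
  ... | _ | other α≢α _ = contradiction refl α≢α

  transpose-second : ∀ α β → transpose α β β ≡ α
  transpose-second α β with transpose α β β | transpose-view α β β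
  ... | _ | first refl  = refl
  ... | _ | second _    = refl
  ... | _ | other _ β≢β = contradiction refl β≢β

  transpose-involutive : ∀ α β γ → transpose α β (transpose α β γ) ≡ γ
  transpose-involutive α β γ with transpose α β γ in eq | transpose-view α β γ
  ... | _ | first refl  = transpose-second α β
  ... | _ | second refl = transpose-first α β
  ... | _ | other _ _   = eq

-- Symmetric in `i` and `j`, so that it survives the exchange of the two entries.
Consecutive : ℕ → ℕ → Set
Consecutive i j = j ≡ suc i ⊎ i ≡ suc j

-- No number lies strictly between `i` and `j`, so any third number is on the same side of both.
consecutive-<ˡ : ∀ {i j k} → Consecutive i j → i < k → j ≢ k → j < k
consecutive-<ˡ (inj₁ refl) i<k j≢k = ℕ.≤∧≢⇒< i<k j≢k
consecutive-<ˡ (inj₂ refl) i<k _   = ℕ.<-trans (ℕ.n<1+n _) i<k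

consecutive-<ʳ : ∀ {i j k} → Consecutive i j → k < i → k ≢ j → k < j
consecutive-<ʳ (inj₁ refl) k<i _   = ℕ.m<n⇒m<1+n k<i
consecutive-<ʳ (inj₂ refl) k<i k≢j = ℕ.≤∧≢⇒< (ℕ.≤-pred k<i) k≢j

module _ {A : Set a} (_≟_ : DecidableEquality A) (f : A → ℕ) (f-injective : Injective _≡_ _≡_ f)
         {α β : A} (consecutive : Consecutive (f α) (f β)) where

  -- The excluded pairs {γ, δ} = {α, β} are the only ones whose order the transposition changes.
  transpose-mono-< : ∀ {γ δ} → ¬ (γ ≡ α × δ ≡ β) → ¬ (γ ≡ β × δ ≡ α) →
                     f γ < f δ → f (transpose _≟_ α β γ) < f (transpose _≟_ α β δ)
  transpose-mono-< {γ} {δ} ¬αβ ¬βα lt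
    with transpose _≟_ α β γ | transpose-view _≟_ α β γ
       | transpose _≟_ α β δ | transpose-view _≟_ α β δ
  ... | _ | first refl    | _ | first refl    = contradiction lt (ℕ.<-irrefl refl)
  ... | _ | first refl    | _ | second refl   = contradiction (refl , refl) ¬αβ
  ... | _ | first refl    | _ | other _ δ≢β   =
    consecutive-<ˡ consecutive lt (δ≢β ∘ sym ∘ f-injective)
  ... | _ | second refl   | _ | first refl    = contradiction (refl , refl) ¬βα
  ... | _ | second refl   | _ | second refl   = contradiction lt (ℕ.<-irrefl refl)
  ... | _ | second refl   | _ | other δ≢α _   =
    consecutive-<ˡ (Sum.swap consecutive) lt (δ≢α ∘ sym ∘ f-injective)
  ... | _ | other _ γ≢β   | _ | first refl    =
    consecutive-<ʳ consecutive lt (γ≢β ∘ f-injective)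
  ... | _ | other γ≢α _   | _ | second refl   =
    consecutive-<ʳ (Sum.swap consecutive) lt (γ≢α ∘ f-injective)
  ... | _ | other _ _     | _ | other _ _     = lt

-- The list of nodes

module _ (μ : Partition n) where

  nodes-complete : IsEnumeration (setoid (Node μ)) (nodes μ)
  nodes-complete (i , j) = ∈ₚ.∈-concat⁺′ (∈ₚ.∈-map⁺ (i ,_) (∈ₚ.∈-allFin j)) (∈ₚ.∈-map⁺ _ (∈ₚ.∈-allFin i))

  nodes-unique : Unique (setoid (Node μ)) (nodes μ)
  nodes-unique = UniqueP.concat⁺
    (All.map⁺ (All.universal (λ i → UniqueP.map⁺ (λ where refl → refl) (UniqueP.allFin⁺ _)) _))
    (AllPairs.map⁺ (AllPairs.map disjoint (UniqueP.allFin⁺ _)))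
    where
    disjoint : ∀ {i i′} → i ≢ i′ → Disjoint (map {B = Node μ} (i ,_) (allFin _)) (map (i′ ,_) (allFin _))
    disjoint i≢i′ (v∈ , v∈′) with ∈ₚ.∈-map⁻ _ v∈ | ∈ₚ.∈-map⁻ _ v∈′
    ... | _ , _ , refl | _ , _ , refl = i≢i′ refl

  nodes-↭ : (σ : Node μ → Node μ) → (∀ γ → σ (σ γ) ≡ γ) →
            Permutation._↭_ (setoid (Node μ)) (map σ (nodes μ)) (nodes μ)
  nodes-↭ σ σσ = involution-↭ (setoid _) nodes-complete nodes-unique σ (cong σ) σσ

-- Pedestals and weights under relabelling of nodes

module _ {μ : Partition n} where

  position : StandardTableau μ → Node μ → ℕ
  position Q = toℕ ∘ entry Q

  position-injective : (Q : StandardTableau μ) → Injective _≡_ _≡_ (position Q)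
  position-injective Q = proj₁ (IsStandard.bijective (isStandard Q)) ∘ Fin.toℕ-injective

  -- The summand of `𝔥 P` at `Q`.
  weight : (P Q : StandardTableau μ) → Polynomial
  weight P Q = ∏ (map (λ γ → x (pedestal P Q γ)) (nodes μ))

  counted? : (P Q : StandardTableau μ) (γ : Node μ) →
             Decidable (λ δ → δ ≺[ Q ] γ × Disagreement P Q δ)
  counted? P Q γ δ = (entry Q δ Fin.<? entry Q γ) ×-dec disagreement? P Q δ

  -- The first tableau enters the pedestal only through the disagreement nodes.
  pedestal-cong : {P P′ Q : StandardTableau μ} → Disagreement P Q ≐ Disagreement P′ Q →
                  pedestal P Q ≗ pedestal P′ Q
  pedestal-cong {P} {P′} {Q} (to , from) γ =
    cong length (filter-≐ (counted? P Q γ) (counted? P′ Q γ) (map₂ to , map₂ from) (nodes μ))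

  weight-cong : {P P′ Q : StandardTableau μ} → Disagreement P Q ≐ Disagreement P′ Q → weight P Q ≈ weight P′ Q
  weight-cong {P} {P′} {Q} D = ≈-reflexive
    (cong ∏ (map-cong (cong x ∘ pedestal-cong {P} {P′} {Q} D) (nodes μ)))

  module _ {P P′ Q Q′ : StandardTableau μ} (σ : Node μ → Node μ) (σσ : ∀ γ → σ (σ γ) ≡ γ)
           (P′≗ : entry P′ ≗ entry P ∘ σ) (Q′≗ : entry Q′ ≗ entry Q ∘ σ) where

    disagreement-relabel : (Disagreement P Q ∘ σ) ≐ Disagreement P′ Q′
    disagreement-relabel = to , from
      where
      to : ∀ {γ} → Disagreement P Q (σ γ) → Disagreement P′ Q′ γ
      to {γ} (δ , next , δ≺γ) = σ δ
        , subst₂ (λ i j → toℕ i ≡ suc (toℕ j))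
            (trans (cong (entry Q) (sym (σσ δ))) (sym (Q′≗ (σ δ)))) (sym (Q′≗ γ)) next
        , subst₂ Fin._<_ (trans (cong (entry P) (sym (σσ δ))) (sym (P′≗ (σ δ)))) (sym (P′≗ γ)) δ≺γ

      from : ∀ {γ} → Disagreement P′ Q′ γ → Disagreement P Q (σ γ)
      from {γ} (δ , next , δ≺γ) = σ δ
        , subst₂ (λ i j → toℕ i ≡ suc (toℕ j)) (Q′≗ δ) (Q′≗ γ) next
        , subst₂ Fin._<_ (P′≗ δ) (P′≗ γ) δ≺γ

    pedestal-relabel : ∀ γ → pedestal P Q (σ γ) ≡ pedestal P′ Q′ γ
    pedestal-relabel γ = trans
      -- The count at `σ γ` is taken over `map σ (nodes μ)`, a reordering of the nodes; `filter-map`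
      -- then moves `σ` into the test.
      (sym (Permutationₚ.xs↭ys⇒|xs|≡|ys| (setoid _)
        (Permutationₚ.filter⁺ (setoid _) R? (λ where refl → id) (nodes-↭ μ σ σσ))))
      (trans (cong length (filter-map R? σ (nodes μ)))
        (trans (length-map σ (filter (R? ∘ σ) (nodes μ)))
          (cong length (filter-≐ (R? ∘ σ) R′? (to , from) (nodes μ)))))
      where
      R?  = counted? P Q (σ γ)
      R′? = counted? P′ Q′ γ

      to : ∀ {δ} → entry Q (σ δ) Fin.< entry Q (σ γ) × Disagreement P Q (σ δ) →
           entry Q′ δ Fin.< entry Q′ γ × Disagreement P′ Q′ δ
      to (lt , D) = subst₂ Fin._<_ (sym (Q′≗ _)) (sym (Q′≗ γ)) lt , proj₁ disagreement-relabel D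

      from : ∀ {δ} → entry Q′ δ Fin.< entry Q′ γ × Disagreement P′ Q′ δ →
             entry Q (σ δ) Fin.< entry Q (σ γ) × Disagreement P Q (σ δ)
      from (lt , D) = subst₂ Fin._<_ (Q′≗ _) (Q′≗ γ) lt , proj₂ disagreement-relabel D

    -- The two pedestals differ by `σ`, and a product over all nodes does not see in which order
    -- they are visited.
    weight-relabel : weight P Q ≈ weight P′ Q′
    weight-relabel = ≈-trans
      (≈-sym (∏-↭ (Permutationₚ.map⁺ (setoid _) ℤ[x]-setoid
        (λ where refl → ≈-refl) (nodes-↭ μ σ σσ))))
      (≈-reflexive (cong ∏ (trans (sym (map-∘ (nodes μ)))
        (map-cong (cong x ∘ pedestal-relabel) (nodes μ)))))

  -- Exchanging two incomparable nodes

  -- Exactly the pairs of nodes, in one column or in one row, whose order standardness prescribes.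
  data _⊏_ (α β : Node μ) : Set where
    in-column : column α ≡ column β → row α < row β → α ⊏ β
    in-row    : row α ≡ row β → column α < column β → α ⊏ β

  ⊏⇒≺ : (Q : StandardTableau μ) → ∀ {α β} → α ⊏ β → α ≺[ Q ] β
  ⊏⇒≺ Q (in-column c r) = IsStandard.increasing-in-i (isStandard Q) _ _ c r
  ⊏⇒≺ Q (in-row r c)    = IsStandard.increasing-in-j (isStandard Q) _ _ r c

  module Exchange {α β : Node μ} (α⋢β : ¬ α ⊏ β) (β⋢α : ¬ β ⊏ α) where

    σ : Node μ → Node μ
    σ = transpose (_≟ᴺ_ μ) α β

    σσ : ∀ γ → σ (σ γ) ≡ γ
    σσ = transpose-involutive (_≟ᴺ_ μ) α β

    Adjacent : Filling μ → Set
    Adjacent Q = Consecutive (toℕ (Q α)) (toℕ (Q β))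

    adjacent? : ∀ Q → Dec (Adjacent Q)
    adjacent? Q = (toℕ (Q β) ℕ.≟ suc (toℕ (Q α))) ⊎-dec (toℕ (Q α) ℕ.≟ suc (toℕ (Q β)))

    adjacent-∘σ : ∀ Q → Adjacent Q → Adjacent (Q ∘ σ)
    adjacent-∘σ Q adj
      rewrite transpose-first (_≟ᴺ_ μ) α β | transpose-second (_≟ᴺ_ μ) α β = Sum.swap adj

    exchange : (Q : StandardTableau μ) → Adjacent (entry Q) → StandardTableau μ
    exchange Q adj = tableau (entry Q ∘ σ) record
      { bijective       =
          (λ {γ} {δ} e → trans (sym (σσ γ)) (trans (cong σ (proj₁ bijective e)) (σσ δ)))
        , λ k → let γ , Qγ≡k = proj₂ bijective k in
                σ γ , λ where refl → Qγ≡k (σσ γ)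
      ; increasing-in-i = λ γ δ c r → mono (in-column c r)
      ; increasing-in-j = λ γ δ r c → mono (in-row r c)
      }
      where
      open IsStandard (isStandard Q)

      mono : ∀ {γ δ} → γ ⊏ δ → entry Q (σ γ) Fin.< entry Q (σ δ)
      mono γ⊏δ = transpose-mono-< (_≟ᴺ_ μ) (position Q) (position-injective Q) adj
        -- The only pair whose order changes is that of `α` and `β`, which `⊏` does not relate.
        (λ where (refl , refl) → α⋢β γ⊏δ) (λ where (refl , refl) → β⋢α γ⊏δ) (⊏⇒≺ Q γ⊏δ)

    -- The involution `Q ↦ Q̃` along which the sum is reindexed.
    exchangeIfAdjacent : StandardTableau μ → StandardTableau μ
    exchangeIfAdjacent Q with adjacent? (entry Q)
    ... | yes adj = exchange Q adj
    ... | no  _   = Q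

    exchangeIfAdjacent-cong : ∀ {Q R : StandardTableau μ} → entry Q ≗ entry R →
                              entry (exchangeIfAdjacent Q) ≗ entry (exchangeIfAdjacent R)
    exchangeIfAdjacent-cong {Q} {R} Q≗R γ with adjacent? (entry Q) | adjacent? (entry R)
    ... | yes _   | yes _   = Q≗R (σ γ)
    ... | no  _   | no  _   = Q≗R γ
    ... | yes adj | no ¬adj =
      contradiction (subst₂ Consecutive (cong toℕ (Q≗R α)) (cong toℕ (Q≗R β)) adj) ¬adj
    ... | no ¬adj | yes adj =
      contradiction (subst₂ Consecutive (cong toℕ (sym (Q≗R α))) (cong toℕ (sym (Q≗R β))) adj) ¬adj

    exchangeIfAdjacent-involutive : ∀ Q → entry (exchangeIfAdjacent (exchangeIfAdjacent Q)) ≗ entry Q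
    exchangeIfAdjacent-involutive Q γ with adjacent? (entry Q) in eq
    -- `Q` is returned unchanged, so the second application repeats the same decision, recorded in
    -- `eq`; in the other case the decision is about `entry Q ∘ σ`.
    ... | no  _   rewrite eq = refl
    ... | yes adj with adjacent? (entry Q ∘ σ)
    ...   | yes _   = cong (entry Q) (σσ γ)
    ...   | no ¬adj = contradiction (adjacent-∘σ (entry Q) adj) ¬adj

    module _ (P : StandardTableau μ) (adjP : Adjacent (entry P)) where

      weight-exchange : ∀ Q → weight P Q ≈ weight (exchange P adjP) (exchangeIfAdjacent Q)
      weight-exchange Q with adjacent? (entry Q)
      ... | yes adjQ = weight-relabel {P} {exchange P adjP} {Q} {exchange Q adjQ} σ σσ
                         (λ _ → refl) (λ _ → refl)
      ... | no ¬adjQ = weight-cong {P} {exchange P adjP} {Q} (to , from)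
        where
        -- Here `δ` comes first because in a disagreement the successor `δ` of `γ` in `Q` precedes
        -- `γ` in the other tableau.
        ¬αβ : ∀ {γ δ} → NextNode Q γ δ → ¬ (δ ≡ α × γ ≡ β)
        ¬αβ next (refl , refl) = ¬adjQ (inj₂ next)

        ¬βα : ∀ {γ δ} → NextNode Q γ δ → ¬ (δ ≡ β × γ ≡ α)
        ¬βα next (refl , refl) = ¬adjQ (inj₁ next)

        to : ∀ {γ} → Disagreement P Q γ → Disagreement (exchange P adjP) Q γ
        to {γ} (δ , next , lt) = δ , next ,
          transpose-mono-< (_≟ᴺ_ μ) (position P) (position-injective P) adjP
            (¬αβ {γ} next) (¬βα {γ} next) lt

        from : ∀ {γ} → Disagreement (exchange P adjP) Q γ → Disagreement P Q γ
        from {γ} (δ , next , lt) = δ , next ,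
          -- Exchanging once more leads back to `P`.
          subst₂ _<_ (cong (position P) (σσ δ)) (cong (position P) (σσ γ))
            (transpose-mono-< (_≟ᴺ_ μ) (position (exchange P adjP))
              (position-injective (exchange P adjP)) (adjacent-∘σ (entry P) adjP)
              (¬αβ {γ} next) (¬βα {γ} next) lt)

      𝔥-exchange : 𝔥 P ≈ 𝔥 (exchange P adjP)
      𝔥-exchange = ≈-trans
        (∑-cong weight-exchange (standardTableaux μ))
        (≈-trans (≈-reflexive (cong ∑ (map-∘ (standardTableaux μ))))
          (∑-↭ (Permutationₚ.map⁺ (𝔰𝔱 μ) ℤ[x]-setoid
            -- The permutation identifies tableaux with equal entries; relabelling by `id` shows
            -- that their weights agree.
            (λ {Q} {R} Q≗R → weight-relabel {exchange P adjP} {exchange P adjP} {Q} {R} id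
              (λ _ → refl) (λ _ → refl) (sym ∘ Q≗R))
            (involution-↭ (𝔰𝔱 μ) (standardTableaux-complete μ) (standardTableaux-unique μ)
              exchangeIfAdjacent (λ {Q} {R} → exchangeIfAdjacent-cong {Q} {R})
              exchangeIfAdjacent-involutive))))

  -- Sorting one tableau into another

  module Sorting (P′ : StandardTableau μ) where

    -- An inverted pair is counted once, with the node that is earlier in `P` written first.
    Inversion : StandardTableau μ → Node μ × Node μ → Set
    Inversion P (γ , δ) = γ ≺[ P ] δ × δ ≺[ P′ ] γ

    inversion? : ∀ P → Decidable (Inversion P)
    inversion? P (γ , δ) = (entry P γ Fin.<? entry P δ) ×-dec (entry P′ δ Fin.<? entry P′ γ)

    pairs : List (Node μ × Node μ)
    pairs = cartesianProduct (nodes μ) (nodes μ)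

    inversions : StandardTableau μ → ℕ
    inversions P = length (filter (inversion? P) pairs)

    ≺-total : (Q : StandardTableau μ) → ∀ {γ δ} → ¬ δ ≺[ Q ] γ → γ ≢ δ → γ ≺[ Q ] δ
    ≺-total Q δ⊀γ γ≢δ = ℕ.≤∧≢⇒< (ℕ.≮⇒≥ δ⊀γ) (γ≢δ ∘ position-injective Q)

    module _ (P : StandardTableau μ) where

      module Swap {α β : Node μ} (next : NextNode P α β) (β≺α : β ≺[ P′ ] α) where

        α≺β : α ≺[ P ] β
        α≺β = subst (position P α <_) (sym next) (ℕ.n<1+n _)

        -- `P` and `P′` order `α` and `β` oppositely while both respect `⊏`, so `⊏` relates them in
        -- neither direction.
        open Exchange (ℕ.<-asym β≺α ∘ ⊏⇒≺ P′) (ℕ.<-asym α≺β ∘ ⊏⇒≺ P)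

        sorted : StandardTableau μ
        sorted = exchange P (inj₁ next)

        𝔥-sorted : 𝔥 P ≈ 𝔥 sorted
        𝔥-sorted = 𝔥-exchange P (inj₁ next)

        ¬Inversion-αβ : ¬ Inversion sorted (α , β)
        ¬Inversion-αβ (lt , _)
          rewrite transpose-first (_≟ᴺ_ μ) α β | transpose-second (_≟ᴺ_ μ) α β =
          ℕ.<-asym lt α≺β

        -- Only the order of `α` and `β` differs between `sorted` and `P`, and `sorted` orders these
        -- two as `P′` does.
        inversion-⊆ : Inversion sorted ⊆ Inversion P
        inversion-⊆ {γ , δ} inv@(lt , δ≺γ) =
          subst₂ _<_ (cong (position P) (σσ γ)) (cong (position P) (σσ δ))
            (transpose-mono-< (_≟ᴺ_ μ) (position sorted) (position-injective sorted)
              (adjacent-∘σ (entry P) (inj₁ next))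
              (λ where (refl , refl) → ¬Inversion-αβ inv)
              (λ where (refl , refl) → ℕ.<-asym β≺α δ≺γ) lt)
          , δ≺γ

        inversions-decrease : inversions sorted < inversions P
        inversions-decrease = length-filter-⊂ (inversion? sorted) (inversion? P) inversion-⊆
          (∈ₚ.∈-cartesianProduct⁺ (nodes-complete μ α) (nodes-complete μ β))
          ¬Inversion-αβ (α≺β , β≺α)

      module _ (agree : ∀ α → ¬ Disagreement P′ P α) where

        predecessor : ∀ {j δ} → position P δ ≡ suc j → ∃[ ε ] position P ε ≡ j
        predecessor {j} {δ} eq =
          map₂ (λ Pε → trans (cong toℕ (Pε refl)) (Fin.toℕ-fromℕ< j<n))
               (proj₂ (IsStandard.bijective (isStandard P)) (Fin.fromℕ< j<n))
          where
          j<n : j < n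
          j<n = ℕ.<-trans (subst (j <_) (sym eq) (ℕ.n<1+n j)) (Fin.toℕ<n (entry P δ))

        next⇒≺ : ∀ {γ δ} → NextNode P γ δ → γ ≺[ P′ ] δ
        next⇒≺ {γ} {δ} next = ≺-total P′ (λ δ≺γ → agree γ (δ , next , δ≺γ))
          λ where refl → ℕ.1+n≢n (sym next)

        -- A chain of nodes consecutive in `P` leads from `γ` to `δ`, and `P′` respects each of its
        -- links. The induction is on the position of `δ`.
        ≺⇒≺ : ∀ {γ δ} → γ ≺[ P ] δ → γ ≺[ P′ ] δ
        ≺⇒≺ {γ} {δ} = go _ refl
          where
          go : ∀ j {δ} → position P δ ≡ j → γ ≺[ P ] δ → γ ≺[ P′ ] δ
          go zero    eq γ≺δ with () ← subst (_ <_) eq γ≺δ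
          go (suc j) {δ} eq γ≺δ
            with ε , ε≡j ← predecessor eq
            with ℕ.m<1+n⇒m<n∨m≡n (subst (position P γ <_) eq γ≺δ)
          ... | inj₁ γ<j = ℕ.<-trans (go j ε≡j (subst (position P γ <_) (sym ε≡j) γ<j))
                                     (next⇒≺ (trans eq (cong suc (sym ε≡j))))
          ... | inj₂ γ≡j = next⇒≺ (trans eq (cong suc (sym γ≡j)))

        -- Disagreement depends on `P` only through its order on nodes, so equal orders suffice; the
        -- converse of `≺⇒≺` follows by totality.
        𝔥-agree : 𝔥 P ≈ 𝔥 P′
        𝔥-agree = ∑-cong (λ Q → weight-cong {P} {P′} {Q}
          ( (λ (δ , next , δ≺γ) → δ , next , ≺⇒≺ δ≺γ)
          , (λ (δ , next , δ≺γ) → δ , next ,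
               ≺-total P (ℕ.<-asym δ≺γ ∘ ≺⇒≺) λ where refl → ℕ.<-irrefl refl δ≺γ)))
          (standardTableaux μ)

    -- Bubble sort: a `(P′, P)`-disagreement node and its successor in `P` are the next pair to
    -- exchange, and each exchange lowers the number of inversions.
    𝔥-sort : ∀ P → Acc _<_ (inversions P) → 𝔥 P ≈ 𝔥 P′
    𝔥-sort P (acc rec) with any?ᴺ μ (disagreement? P′ P)
    ... | no  agree = 𝔥-agree P λ α D → agree (α , D)
    ... | yes (α , β , next , β≺α) = ≈-trans 𝔥-sorted (𝔥-sort sorted (rec inversions-decrease))
      where open Swap P next β≺α

theorem2 : (n : ℕ) → 1 ≤ n → (μ : Partition n) → (P P′ : StandardTableau μ) → 𝔥 P ≈ 𝔥 P′
theorem2 n _ μ P P′ = Sorting.𝔥-sort P′ P (<-wellFounded _)
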